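{- Let $G$ be a finite group, $S$ a non-empty inverse-closed subset of $G\setminus\{1\}$, $\mathbb{F}$ a finite field, and $B\le\mathbb{F}^S$ a linear code. Let $L=A(G,S,B)$ be the group of all $\sigma\in\mathrm{Aut}(G)$ such that $S^\sigma=S$ and the permutation of $S$ induced by $\sigma$ lies in $\mathrm{Aut}(B)$. Let $S=\bigcup_{i\in\mathbf{I}}S_i$ be the unique finest partition of $S$ such that each part $S_i$ is both inverse-closed and $L$-invariant. For each $i\in\mathbf{I}$ let $B_i=\{b|_{S_i}\mid b\in B\}\le\mathbb{F}^{S_i}$ be the restriction of $B$ to $S_i$. Then for each $i\in\mathbf{I}$, the Cayley graph $\mathrm{Cay}(G,S_i)$ is normal edge-transitive and the Cayley code $\mathbf{C}(G,S_i,B_i)$ is symmetric. Further, if $B=\bigoplus_{i\in\mathbf{I}}B_i$, then $\mathbf{C}(G,S,B)=\bigoplus_{i\in\mathbf{I}}\mathbf{C}(G,S_i,B_i)$.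
   Context: For a finite set $X$, $\mathbb{F}^X$ is the $\mathbb{F}$-vector space of functions $f:X\to\mathbb{F}$; a linear code is a subspace $C\le\mathbb{F}^X$. $\mathrm{Aut}(C)$ is the group of all $\rho\in\mathrm{Sym}(X)$ whose induced action on $\mathbb{F}^X$ leaves $C$ invariant; $C$ is symmetric if $\mathrm{Aut}(C)$ is transitive on $X$. If $X=\bigcup_k X_k$ is a disjoint union then $\mathbb{F}^X=\bigoplus_k\mathbb{F}^{X_k}$ (via restriction of functions), and direct sums of codes $C_k\le\mathbb{F}^{X_k}$ are taken inside $\mathbb{F}^X$ in this sense. For a finite group $G$ and a non-empty inverse-closed subset $S\subseteq G\setminus\{1\}$, the Cayley graph $\mathrm{Cay}(G,S)$ has vertex set $G$ and edge set $E=\{\{g,sg\}\mid g\in G,\ s\in S\}$. It admits as automorphisms the elements of $G\rtimes A(G,S)$, where $A(G,S)=\{\sigma\in\mathrm{Aut}(G)\mid S^\sigma=S\}$, with $x\in G$ acting on vertices by $g\mapsto gx$ and $\sigma\in A(G,S)$ acting by $g\mapsto g^\sigma$. $\mathrm{Cay}(G,S)$ is normal edge-transitive if $G\rtimes A(G,S)$ is transitive on its edge set. For a linear code $B\le\mathbb{F}^S$, the Cayley code is $$\mathbf{C}(G,S,B)=\{f\in\mathbb{F}^E\mid \text{for all } g\in G, \text{ the function } S\to\mathbb{F},\ s\mapsto f(\{g,sg\}), \text{ lies in } B\}.$$ The edge set of $\mathrm{Cay}(G,S)$ is the disjoint union of the edge sets of the graphs $\mathrm{Cay}(G,S_i)$.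 -}

module Defs where

open import Level using (Level; suc)
open import Algebra.Bundles using (Group; CommutativeRing)
open import Algebra.Morphism.Structures using (module GroupMorphisms)
import Algebra.Properties.Group as GroupProperties
open import Data.Fin.Base using (Fin)
open import Data.Product.Base using (Σ; ∃-syntax; Σ-syntax; _×_; _,_; proj₁; proj₂; map₂)
open import Data.Sum.Base using (_⊎_; inj₁; inj₂)
open import Function.Base using (_∘_)
open import Function.Bundles using (Func; Injection; Inverse)
import Function.Construct.Composition as Compose
open import Relation.Binary.Bundles using (Setoid)
import Relation.Binary.Construct.On as On
open import Relation.Binary.Definitions using (_Respects_)
import Relation.Binary.PropositionalEquality.Properties as ≡
open import Relation.Nullary.Negation.Core using (¬_)
open import Relation.Unary using (Pred; _∈_; _⊆_; _≐_)

-- Sets are setoids; every function is required to respect the equalities.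
-- Everything lives in one (arbitrary) universe level ℓ.

IsFinite : ∀ {ℓ} → Setoid ℓ ℓ → Set ℓ
IsFinite X = ∃[ n ] Inverse X (≡.setoid (Fin n))

record FiniteField (ℓ : Level) : Set (suc ℓ) where
  field
    commutativeRing : CommutativeRing ℓ ℓ
  open CommutativeRing commutativeRing public
  field
    1≉0     : ¬ (1# ≈ 0#)
    inverse : ∀ x → ¬ (x ≈ 0#) → ∃[ y ] (x * y) ≈ 1#
    finite  : IsFinite setoid

record Subset {ℓ} (X : Setoid ℓ ℓ) : Set (suc ℓ) where
  open Setoid X
  field
    Mem      : Pred Carrier ℓ
    respects : Mem Respects _≈_

open Subset public using (Mem)

⟦_⟧ : ∀ {ℓ} {X : Setoid ℓ ℓ} → Subset X → Setoid ℓ ℓ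
⟦_⟧ {X = X} S = On.setoid X (proj₁ {B = Mem S})

Nonempty : ∀ {ℓ} {X : Setoid ℓ ℓ} → Subset X → Set ℓ
Nonempty S = ∃[ x ] x ∈ Mem S

inclusion : ∀ {ℓ} {X : Setoid ℓ ℓ} (S T : Subset X) → Mem S ⊆ Mem T → Injection ⟦ S ⟧ ⟦ T ⟧
inclusion _ _ S⊆T = record { to = map₂ S⊆T ; cong = λ e → e ; injective = λ e → e }

Perm : ∀ {ℓ} → Setoid ℓ ℓ → Set ℓ
Perm X = Inverse X X

IsTransitive : ∀ {ℓ} {X : Setoid ℓ ℓ} → Pred (Perm X) ℓ → Set ℓ
IsTransitive {X = X} H = ∀ x y → ∃[ ρ ] ρ ∈ H × Inverse.to ρ x ≈ y
  where open Setoid X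

-- The set of unordered pairs {x, y}, where x and y may coincide.

UnorderedPair : ∀ {ℓ} → Setoid ℓ ℓ → Setoid ℓ ℓ
UnorderedPair X = record
  { Carrier       = Carrier × Carrier
  ; _≈_           = λ (a , b) (c , d) → (a ≈ c × b ≈ d) ⊎ (a ≈ d × b ≈ c)
  ; isEquivalence = record
    { refl  = inj₁ (refl , refl)
    ; sym   = λ { (inj₁ (p , q)) → inj₁ (sym p , sym q)
                ; (inj₂ (p , q)) → inj₂ (sym q , sym p) }
    ; trans = λ { (inj₁ (p , q)) (inj₁ (r , s)) → inj₁ (trans p r , trans q s)
                ; (inj₁ (p , q)) (inj₂ (r , s)) → inj₂ (trans p r , trans q s)
                ; (inj₂ (p , q)) (inj₁ (r , s)) → inj₂ (trans p s , trans q r)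
                ; (inj₂ (p , q)) (inj₂ (r , s)) → inj₁ (trans p s , trans q r) }
    }
  }
  where open Setoid X

-- S = ⋃ᵢ partᵢ.  The laws make i ≈ᴵ j hold exactly when
-- partᵢ and partⱼ are the same part.

record Partition {ℓ} {X : Setoid ℓ ℓ} (S : Subset X) : Set (suc ℓ) where
  field
    Index : Setoid ℓ ℓ
  open Setoid Index using () renaming (Carrier to I; _≈_ to _≈ᴵ_) public
  field
    part       : I → Subset X
    respects-≈ : ∀ {i j} → i ≈ᴵ j → Mem (part i) ⊆ Mem (part j)
    nonempty   : ∀ i → Nonempty (part i)
    part⊆      : ∀ i → Mem (part i) ⊆ Mem S
    cover      : ∀ {x} → x ∈ Mem S → ∃[ i ] x ∈ Mem (part i)
    disjoint   : ∀ {i j x} → x ∈ Mem (part i) → x ∈ Mem (part j) → i ≈ᴵ j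

_Refines_ : ∀ {ℓ} {X : Setoid ℓ ℓ} {S : Subset X} → Partition S → Partition S → Set ℓ
P Refines Q = ∀ i → ∃[ j ] Mem (P.part i) ⊆ Mem (Q.part j)
  where
  module P = Partition P
  module Q = Partition Q

-- X as the disjoint union of the images of the injections ι i.

record DisjointUnion {ℓ} (X : Setoid ℓ ℓ) : Set (suc ℓ) where
  field
    Index : Setoid ℓ ℓ
  open Setoid Index using () renaming (Carrier to I; _≈_ to _≈ᴵ_) public
  open Setoid X using (_≈_)
  field
    Part : I → Setoid ℓ ℓ
    ι    : ∀ i → Injection (Part i) X
  _at_ : ∀ i → Setoid.Carrier (Part i) → Setoid.Carrier X
  i at x = Injection.to (ι i) x
  field
    respects-≈ : ∀ {i j} → i ≈ᴵ j → ∀ x → ∃[ y ] (i at x) ≈ (j at y)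
    cover      : ∀ x → ∃[ i ] ∃[ y ] (i at y) ≈ x
    disjoint   : ∀ {i j x y} → (i at x) ≈ (j at y) → i ≈ᴵ j

partitionUnion : ∀ {ℓ} {X : Setoid ℓ ℓ} {S : Subset X} → Partition S → DisjointUnion ⟦ S ⟧
partitionUnion {X = X} {S} P = record
  { Index      = P.Index
  ; Part       = λ i → ⟦ P.part i ⟧
  ; ι          = λ i → inclusion (P.part i) S (P.part⊆ i)
  ; respects-≈ = λ i≈j (x , x∈) → (x , P.respects-≈ i≈j x∈) , refl
  ; cover      = λ (x , x∈S) → let (i , x∈) = P.cover x∈S in i , (x , x∈) , refl
  ; disjoint   = λ {i} {j} {(_ , x∈)} {(_ , y∈)} x≈y →
                   P.disjoint x∈ (Subset.respects (P.part j) (sym x≈y) y∈)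
  }
  where
  open Setoid X
  module P = Partition P

module Codes {ℓ} (F : FiniteField ℓ) where

  private
    module F = FiniteField F

  -- 𝔽^X
  𝔽^ : Setoid ℓ ℓ → Set ℓ
  𝔽^ X = Func X F.setoid

  module _ {X : Setoid ℓ ℓ} where
    open Func

    _≋_ : 𝔽^ X → 𝔽^ X → Set ℓ
    f ≋ g = ∀ x → to f x F.≈ to g x

    𝟎 : 𝔽^ X
    𝟎 = record { to = λ _ → F.0# ; cong = λ _ → F.refl }

    _⊹_ : 𝔽^ X → 𝔽^ X → 𝔽^ X
    f ⊹ g = record
      { to   = λ x → to f x F.+ to g x
      ; cong = λ e → F.+-cong (cong f e) (cong g e) }

    _·_ : F.Carrier → 𝔽^ X → 𝔽^ X
    a · f = record
      { to   = λ x → a F.* to f x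
      ; cong = λ e → F.*-cong F.refl (cong f e) }

  record LinearCode (X : Setoid ℓ ℓ) : Set (suc ℓ) where
    field
      Word     : Pred (𝔽^ X) ℓ
      respects : Word Respects _≋_
      𝟎-closed : 𝟎 ∈ Word
      ⊹-closed : ∀ {f g} → f ∈ Word → g ∈ Word → (f ⊹ g) ∈ Word
      ·-closed : ∀ a {f} → f ∈ Word → (a · f) ∈ Word

  open LinearCode public using (Word)

  _≐ᶜ_ : ∀ {X} → LinearCode X → LinearCode X → Set ℓ
  C ≐ᶜ D = Word C ≐ Word D

  -- The restriction of f along an embedding of Y in X.
  _∣_ : ∀ {X Y} → 𝔽^ X → Injection Y X → 𝔽^ Y
  f ∣ ι = Compose.function (Injection.function ι) f

  restrict : ∀ {X Y} → LinearCode X → Injection Y X → LinearCode Y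
  restrict C ι = record
    { Word     = λ f → ∃[ b ] b ∈ Word C × (b ∣ ι) ≋ f
    ; respects = λ f≋g (b , b∈ , e) → b , b∈ , λ y → F.trans (e y) (f≋g y)
    ; 𝟎-closed = 𝟎 , C.𝟎-closed , λ _ → F.refl
    ; ⊹-closed = λ (b , b∈ , e) (c , c∈ , e′) →
                   (b ⊹ c) , C.⊹-closed b∈ c∈ , λ y → F.+-cong (e y) (e′ y)
    ; ·-closed = λ a (b , b∈ , e) → (a · b) , C.·-closed a b∈ , λ y → F.*-cong F.refl (e y)
    }
    where module C = LinearCode C

  -- The direct sum inside 𝔽^X ≅ ⨁ᵢ 𝔽^(Xᵢ), where f corresponds to the
  -- family of its restrictions to the parts Xᵢ.
  ⨁ : ∀ {X} (D : DisjointUnion X) (let open DisjointUnion D) →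
      (∀ i → LinearCode (Part i)) → LinearCode X
  ⨁ D C = record
    { Word     = λ f → ∀ i → (f ∣ ι i) ∈ Word (C i)
    ; respects = λ f≋g f∈ i → LinearCode.respects (C i) (λ y → f≋g (i at y)) (f∈ i)
    ; 𝟎-closed = λ i → LinearCode.respects (C i) (λ _ → F.refl) (LinearCode.𝟎-closed (C i))
    ; ⊹-closed = λ f∈ g∈ i → LinearCode.respects (C i) (λ _ → F.refl)
                               (LinearCode.⊹-closed (C i) (f∈ i) (g∈ i))
    ; ·-closed = λ a f∈ i → LinearCode.respects (C i) (λ _ → F.refl)
                              (LinearCode.·-closed (C i) a (f∈ i))
    }
    where open DisjointUnion D

  -- The right action of Sym(X) on 𝔽^X: (f ^ ρ)(x) = f(ρ⁻¹ x).
  _^_ : ∀ {X} → 𝔽^ X → Perm X → 𝔽^ X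
  f ^ ρ = record
    { to   = Func.to f ∘ Inverse.from ρ
    ; cong = Func.cong f ∘ Inverse.from-cong ρ }

  -- The two inclusions of C ^ ρ = C.
  Aut : ∀ {X} → LinearCode X → Pred (Perm X) ℓ
  Aut C ρ = ∀ f → (f ∈ Word C → (f ^ ρ) ∈ Word C) × ((f ^ ρ) ∈ Word C → f ∈ Word C)

  IsSymmetric : ∀ {X} → LinearCode X → Set ℓ
  IsSymmetric C = IsTransitive (Aut C)

module Cayley {ℓ} (G : Group ℓ ℓ) where

  open Group G
  open GroupProperties G using (∙-cancelʳ; inverseˡ-unique)
  open GroupMorphisms rawGroup rawGroup using (IsGroupHomomorphism)

  InverseClosed : Subset setoid → Set ℓ
  InverseClosed S = ∀ {s} → s ∈ Mem S → (s ⁻¹) ∈ Mem S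

  record Automorphism : Set ℓ where
    field
      perm           : Perm setoid
      isHomomorphism : IsGroupHomomorphism (Inverse.to perm)
    open Inverse perm public

  -- The image S^σ; y lies in it exactly when σ⁻¹ y lies in S.
  _^ˢ_ : Subset setoid → Automorphism → Pred Carrier ℓ
  (S ^ˢ σ) y = Automorphism.from σ y ∈ Mem S

  -- A(G,S)
  A : Subset setoid → Pred Automorphism ℓ
  A S σ = (S ^ˢ σ) ≐ Mem S

  induced : ∀ (S : Subset setoid) σ → σ ∈ A S → Perm ⟦ S ⟧
  induced S σ (S^σ⊆S , S⊆S^σ) = record
    { to        = λ (s , s∈) → σ.to s , S^σ⊆S (Subset.respects S (sym (σ.strictlyInverseʳ s)) s∈)
    ; from      = λ (s , s∈) → σ.from s , S⊆S^σ s∈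
    ; to-cong   = σ.to-cong
    ; from-cong = σ.from-cong
    ; inverse   = σ.inverseˡ , σ.inverseʳ
    }
    where module σ = Automorphism σ

  -- The edge set of Cay(G,S): the pair (g , s) stands for the edge {g, sg}.
  endpoints : (S : Subset setoid) → Carrier × Σ Carrier (Mem S) → Carrier × Carrier
  endpoints S (g , (s , _)) = g , s ∙ g

  Edge : Subset setoid → Setoid ℓ ℓ
  Edge S = On.setoid (UnorderedPair setoid) (endpoints S)

  -- An element xσ of G ⋊ A(G,S) maps the vertex g to (gx)^σ.
  IsNormalEdgeTransitive : Subset setoid → Set ℓ
  IsNormalEdgeTransitive S =
    ∀ (e e′ : Setoid.Carrier (Edge S)) → ∃[ x ] ∃[ σ ] σ ∈ A S ×
      (let (u , v) = endpoints S e
           act g   = Automorphism.to σ (g ∙ x)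
       in Setoid._≈_ (UnorderedPair setoid) (act u , act v) (endpoints S e′))

  edgeInclusion : ∀ S T → Mem S ⊆ Mem T → Injection (Edge S) (Edge T)
  edgeInclusion _ _ S⊆T = record
    { to = map₂ (map₂ S⊆T) ; cong = λ e → e ; injective = λ e → e }

  edgeUnion : ∀ {S} (P : Partition S) → (∀ i → InverseClosed (Partition.part P i)) →
              DisjointUnion (Edge S)
  edgeUnion {S} P inv = record
    { Index      = P.Index
    ; Part       = λ i → Edge (P.part i)
    ; ι          = λ i → edgeInclusion (P.part i) S (P.part⊆ i)
    ; respects-≈ = λ i≈j (g , (s , s∈)) → (g , (s , P.respects-≈ i≈j s∈)) , inj₁ (refl , refl)
    ; cover      = λ (g , (s , s∈S)) →
                     let (i , s∈) = P.cover s∈S in i , (g , (s , s∈)) , inj₁ (refl , refl)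
    ; disjoint   = λ {i} {j} {(g , (s , s∈))} {(h , (t , t∈))} → λ
        { (inj₁ (g≈h , sg≈th)) →
            P.disjoint s∈ (Subset.respects (P.part j)
              (sym (∙-cancelʳ g s t (trans sg≈th (∙-congˡ (sym g≈h))))) t∈)
        ; (inj₂ (g≈th , sg≈h)) →
            P.disjoint s∈ (Subset.respects (P.part j)
              (sym (inverseˡ-unique s t (∙-cancelʳ h (s ∙ t) ε
                (trans (assoc s t h) (trans (∙-congˡ (sym g≈th)) (trans sg≈h (sym (identityˡ h))))))))
              (inv j t∈))
        }
    }
    where module P = Partition P

  module _ (F : FiniteField ℓ) where

    open Codes F
    private
      module F = FiniteField F

    -- A(G,S,B)
    L : (S : Subset setoid) → LinearCode ⟦ S ⟧ → Pred Automorphism ℓ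
    L S B σ = Σ[ σ∈A ∈ σ ∈ A S ] induced S σ σ∈A ∈ Aut B

    -- The function s ↦ f({g, sg}).
    star : (S : Subset setoid) → 𝔽^ (Edge S) → Carrier → 𝔽^ ⟦ S ⟧
    star S f g = record
      { to   = λ s → Func.to f (g , s)
      ; cong = λ s≈t → Func.cong f (inj₁ (refl , ∙-congʳ s≈t)) }

    cayleyCode : (S : Subset setoid) → LinearCode ⟦ S ⟧ → LinearCode (Edge S)
    cayleyCode S B = record
      { Word     = λ f → ∀ g → star S f g ∈ Word B
      ; respects = λ f≋f′ f∈ g → B.respects (λ s → f≋f′ (g , s)) (f∈ g)
      ; 𝟎-closed = λ g → B.respects (λ _ → F.refl) B.𝟎-closed
      ; ⊹-closed = λ f∈ f′∈ g → B.respects (λ _ → F.refl) (B.⊹-closed (f∈ g) (f′∈ g))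
      ; ·-closed = λ a f∈ g → B.respects (λ _ → F.refl) (B.·-closed a (f∈ g))
      }
      where module B = LinearCode B

    module _ {S : Subset setoid} (B : LinearCode ⟦ S ⟧) where

      record IsInvariantPartition (P : Partition S) : Set ℓ where
        open Partition P
        field
          inverseClosed : ∀ i → InverseClosed (part i)
          L-invariant   : ∀ i σ → σ ∈ L S B → (part i ^ˢ σ) ≐ Mem (part i)

      record IsFinestInvariantPartition (P : Partition S) : Set (suc ℓ) where
        field
          isInvariant : IsInvariantPartition P
          finest      : ∀ Q → IsInvariantPartition Q → P Refines Q
        open IsInvariantPartition isInvariant public

      restrictTo : (P : Partition S) → ∀ i → LinearCode ⟦ Partition.part P i ⟧
      restrictTo P i = restrict B (DisjointUnion.ι (partitionUnion P) i)

{-# OPTIONS --safe #-}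

-- The orbits on S of the group generated by L and inversion form an invariant
-- partition, so each part Sᵢ of the finest one lies in a single orbit: for s, t ∈ Sᵢ
-- some σ ∈ L maps s to t or to t⁻¹.  Choosing x ∈ G so that xσ maps g to h or to th
-- accordingly, xσ maps the edge {g, sg} to {h, th}.  As σ induces an automorphism
-- of Bᵢ, the action of xσ on edges preserves C(G,Sᵢ,Bᵢ), so both transitivity claims
-- follow.  The decomposition of C(G,S,B) holds because taking stars commutes with
-- restriction to the parts.

module Submission where

open import Defs
open import Algebra.Bundles using (Group)
open import Algebra.Morphism.Structures using (module GroupMorphisms)
import Algebra.Morphism.Construct.Composition as GroupCompose
import Algebra.Morphism.Construct.Identity as GroupId
import Algebra.Properties.Group as GroupProperties
open import Data.Product.Base using (∃-syntax; Σ-syntax; _×_; _,_; proj₁; proj₂)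
open import Data.Sum.Base using (_⊎_; inj₁; inj₂)
open import Function.Base using (id; _∘_)
open import Function.Bundles using (Func; Injection; Inverse)
import Function.Construct.Composition as Compose
import Function.Construct.Identity as Id
import Function.Construct.Symmetry as Symmetry
open import Function.Definitions using (Congruent)
open import Relation.Binary.Bundles using (Setoid)
open import Relation.Unary using (_∈_; _∉_; _⊆_)

-- Automorphisms of linear codes and of their restrictions.

module CodeAutomorphisms {ℓ} (F : FiniteField ℓ) where

  open Codes F
  private
    module F = FiniteField F

  open LinearCode using (respects)

  module _ {X : Setoid ℓ ℓ} (C : LinearCode X) where

    open Setoid X using (_≈_)

    -- The action on words uses only `Inverse.from`, so agreement there suffices. This lets the
    -- permutation induced by a composite or an inverse be replaced by the composite or inverse of
    -- the induced ones.
    Aut-resp : ∀ (ρ π : Perm X) → (∀ x → Inverse.from ρ x ≈ Inverse.from π x) →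
               ρ ∈ Aut C → π ∈ Aut C
    Aut-resp ρ π ρ≈π ρ∈ f =
      (λ f∈ → respects C e (proj₁ (ρ∈ f) f∈)) ,
      (λ fπ∈ → proj₂ (ρ∈ f) (respects C (λ x → F.sym (e x)) fπ∈))
      where
      e : (f ^ ρ) ≋ (f ^ π)
      e x = Func.cong f (ρ≈π x)

    Aut-id : Id.inverse X ∈ Aut C
    Aut-id f = respects C (λ _ → F.refl) , respects C (λ _ → F.refl)

    Aut-inverse : ∀ (ρ : Perm X) → ρ ∈ Aut C → Symmetry.inverse ρ ∈ Aut C
    Aut-inverse ρ ρ∈ f =
      (λ f∈ → proj₂ (ρ∈ (f ^ Symmetry.inverse ρ)) (respects C (λ x → F.sym (e x)) f∈)) ,
      (λ f′∈ → respects C e (proj₁ (ρ∈ (f ^ Symmetry.inverse ρ)) f′∈))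
      where
      e : ((f ^ Symmetry.inverse ρ) ^ ρ) ≋ f
      e x = Func.cong f (Inverse.strictlyInverseˡ ρ x)

    Aut-compose : ∀ (ρ π : Perm X) → ρ ∈ Aut C → π ∈ Aut C → Compose.inverse ρ π ∈ Aut C
    Aut-compose ρ π ρ∈ π∈ f =
      (λ f∈ → respects C (λ _ → F.refl) (proj₁ (π∈ (f ^ ρ)) (proj₁ (ρ∈ f) f∈))) ,
      (λ f′∈ → proj₂ (ρ∈ f) (proj₂ (π∈ (f ^ ρ)) (respects C (λ _ → F.refl) f′∈)))

    -- Since `f` is the image of `f ^ ρ` under the inverse of `ρ`, the reverse inclusion follows
    -- from closure of `C` under that inverse.
    Aut-intro : ∀ (ρ : Perm X) →
                (∀ f → f ∈ Word C → (f ^ ρ) ∈ Word C) →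
                (∀ f → f ∈ Word C → (f ^ Symmetry.inverse ρ) ∈ Word C) →
                ρ ∈ Aut C
    Aut-intro ρ to from f =
      to f ,
      λ f′∈ → respects C (λ x → Func.cong f (Inverse.strictlyInverseʳ ρ x)) (from (f ^ ρ) f′∈)

  module _ {X Y : Setoid ℓ ℓ} (C : LinearCode X) (ι : Injection Y X) where

    open Setoid X using (_≈_)

    private
      ι⟨_⟩ = Injection.to ι

    -- A word `f` of the restriction lifts to some `b` in `C`; as the inverses of `ρ` and `π` agree
    -- along `ι`, `b ^ ρ` lifts `f ^ π`.
    restrict-^ : ∀ (ρ : Perm X) (π : Perm Y) → ρ ∈ Aut C →
                 (∀ y → Inverse.from ρ ι⟨ y ⟩ ≈ ι⟨ Inverse.from π y ⟩) →
                 ∀ f → f ∈ Word (restrict C ι) → (f ^ π) ∈ Word (restrict C ι)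
    restrict-^ ρ π ρ∈ e f (b , b∈ , b∣≋f) =
      (b ^ ρ) , proj₁ (ρ∈ b) b∈ , λ y → F.trans (Func.cong b (e y)) (b∣≋f (Inverse.from π y))

    Aut-restrict : ∀ (ρ : Perm X) (π : Perm Y) → ρ ∈ Aut C →
                   (∀ y → Inverse.to ρ ι⟨ y ⟩ ≈ ι⟨ Inverse.to π y ⟩) →
                   π ∈ Aut (restrict C ι)
    Aut-restrict ρ π ρ∈ e = Aut-intro (restrict C ι) π
      -- `e` compares the forward maps; taken at `Inverse.from π y`, it yields the comparison of
      -- inverses. For the inverse permutations `e` serves as it stands.
      (restrict-^ ρ π ρ∈ λ y → Inverse.inverseʳ ρ
        (X.trans (Injection.cong ι (Y.sym (Inverse.strictlyInverseˡ π y)))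
                 (X.sym (e (Inverse.from π y)))))
      (restrict-^ (Symmetry.inverse ρ) (Symmetry.inverse π) (Aut-inverse C ρ ρ∈) e)
      where
      module X = Setoid X
      module Y = Setoid Y

module CayleyAutomorphisms {ℓ} (G : Group ℓ ℓ) where

  open Group G
  open Cayley G
  open GroupProperties G
    using (⁻¹-involutive; \\-leftDividesˡ; \\-leftDividesʳ; //-rightDividesˡ; //-rightDividesʳ)
  open GroupMorphisms rawGroup rawGroup using (IsGroupHomomorphism)

  private
    module Pair = Setoid (UnorderedPair setoid)
    module Hom (σ : Automorphism) = IsGroupHomomorphism (Automorphism.isHomomorphism σ)

  -- The group of automorphisms of G and its subgroup A(G,S).

  idᴬ : Automorphism
  idᴬ = record
    { perm           = Id.inverse setoid
    ; isHomomorphism = GroupId.isGroupHomomorphism rawGroup refl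
    }

  inverseᴬ : Automorphism → Automorphism
  inverseᴬ σ = record
    { perm           = Symmetry.inverse σ.perm
    ; isHomomorphism = record
      { isMonoidHomomorphism = record
        { isMagmaHomomorphism = record
          { isRelHomomorphism = record { cong = σ.from-cong }
          ; homo = λ x y → σ.inverseʳ
              (trans (∙-cong (sym (σ.strictlyInverseˡ x)) (sym (σ.strictlyInverseˡ y)))
                     (sym (Hom.homo σ (σ.from x) (σ.from y))))
          }
        ; ε-homo = σ.inverseʳ (sym (Hom.ε-homo σ))
        }
      ; ⁻¹-homo = λ x → σ.inverseʳ
          (trans (⁻¹-cong (sym (σ.strictlyInverseˡ x))) (sym (Hom.⁻¹-homo σ (σ.from x))))
      }
    }
    where module σ = Automorphism σ

  composeᴬ : Automorphism → Automorphism → Automorphism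
  composeᴬ σ τ = record
    { perm           = Compose.inverse (Automorphism.perm σ) (Automorphism.perm τ)
    ; isHomomorphism = GroupCompose.isGroupHomomorphism trans
        (Automorphism.isHomomorphism σ) (Automorphism.isHomomorphism τ)
    }

  module _ {S : Subset setoid} where

    A-id : idᴬ ∈ A S
    A-id = id , id

    A-inverse : ∀ σ → σ ∈ A S → inverseᴬ σ ∈ A S
    A-inverse σ (S^σ⊆S , S⊆S^σ) =
      (λ {y} σy∈ → resp (σ.strictlyInverseʳ y) (S⊆S^σ σy∈)) ,
      (λ {y} y∈ → S^σ⊆S (resp (sym (σ.strictlyInverseʳ y)) y∈))
      where
      module σ = Automorphism σ
      resp = Subset.respects S

    A-compose : ∀ σ τ → σ ∈ A S → τ ∈ A S → composeᴬ σ τ ∈ A S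
    A-compose σ τ (S^σ⊆S , S⊆S^σ) (S^τ⊆S , S⊆S^τ) = S^τ⊆S ∘ S^σ⊆S , S⊆S^σ ∘ S⊆S^τ

  -- Equality up to inversion.

  infix 4 _≈±_

  -- The pairs `(g , s)` and `(s ∙ g , s ⁻¹)` stand for the same edge, so the label of an edge is
  -- determined only up to inversion.
  _≈±_ : Carrier → Carrier → Set ℓ
  s ≈± t = s ≈ t ⊎ s ≈ t ⁻¹

  ≈±-sym : ∀ {s t} → s ≈± t → t ≈± s
  ≈±-sym (inj₁ s≈t)   = inj₁ (sym s≈t)
  ≈±-sym (inj₂ s≈t⁻¹) = inj₂ (trans (sym (⁻¹-involutive _)) (⁻¹-cong (sym s≈t⁻¹)))

  ≈±-⁻¹ʳ : ∀ {s t} → s ≈± t → s ≈± t ⁻¹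
  ≈±-⁻¹ʳ (inj₁ s≈t)   = inj₂ (trans s≈t (sym (⁻¹-involutive _)))
  ≈±-⁻¹ʳ (inj₂ s≈t⁻¹) = inj₁ s≈t⁻¹

  ≈±-respʳ : ∀ {s t u} → t ≈ u → s ≈± t → s ≈± u
  ≈±-respʳ t≈u (inj₁ s≈t)   = inj₁ (trans s≈t t≈u)
  ≈±-respʳ t≈u (inj₂ s≈t⁻¹) = inj₂ (trans s≈t⁻¹ (⁻¹-cong t≈u))

  ≈±-trans : ∀ {s t u} → s ≈± t → t ≈± u → s ≈± u
  ≈±-trans s≈±t (inj₁ t≈u)   = ≈±-respʳ t≈u s≈±t
  ≈±-trans s≈±t (inj₂ t≈u⁻¹) =
    ≈±-respʳ (⁻¹-involutive _) (≈±-⁻¹ʳ (≈±-respʳ t≈u⁻¹ s≈±t))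

  ≈±-map : ∀ σ {s t} → s ≈± t → Automorphism.to σ s ≈± Automorphism.to σ t
  ≈±-map σ (inj₁ s≈t)   = inj₁ (Automorphism.to-cong σ s≈t)
  ≈±-map σ (inj₂ s≈t⁻¹) = inj₂ (trans (Automorphism.to-cong σ s≈t⁻¹) (Hom.⁻¹-homo σ _))

  -- The action of xσ on vertices.

  rightTranslation : Carrier → Perm setoid
  rightTranslation x = record
    { to        = _∙ x
    ; from      = _// x
    ; to-cong   = ∙-congʳ
    ; from-cong = ∙-congʳ
    ; inverse   = (λ e → trans (∙-congʳ e) (//-rightDividesˡ x _)) ,
                  (λ e → trans (∙-congʳ e) (//-rightDividesʳ x _))
    }

  vertexPerm : Automorphism → Carrier → Perm setoid
  vertexPerm σ x = Compose.inverse (rightTranslation x) (Automorphism.perm σ)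

  -- Since `(sgx)^σ` is `s^σ (gx)^σ`, the vertex map sends edges to edges and moves their labels by
  -- `σ`.
  vertexPerm-∙ : ∀ σ x s g → let θ = Inverse.to (vertexPerm σ x) in
                 Automorphism.to σ s ∙ θ g ≈ θ (s ∙ g)
  vertexPerm-∙ σ x s g =
    trans (sym (Hom.homo σ s (g ∙ x))) (Automorphism.to-cong σ (sym (assoc s g x)))

  vertexPerm-from-∙ : ∀ σ x s g → let θ⁻¹ = Inverse.from (vertexPerm σ x) in
                      Automorphism.from σ s ∙ θ⁻¹ g ≈ θ⁻¹ (s ∙ g)
  vertexPerm-from-∙ σ x s g =
    trans (sym (assoc _ _ _)) (∙-congʳ (sym (Hom.homo (inverseᴬ σ) s g)))

  vertexPerm-mapsTo : ∀ σ g h → ∃[ x ] Inverse.to (vertexPerm σ x) g ≈ h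
  vertexPerm-mapsTo σ g h =
    -- The witness solves `g ∙ x = σ⁻¹ h`.
    g \\ Automorphism.from σ h , Automorphism.inverseˡ σ (\\-leftDividesˡ g _)

  pair-cong : ∀ {φ : Carrier → Carrier} → Congruent _≈_ _≈_ φ → ∀ {a b c d} →
              (a , b) Pair.≈ (c , d) → (φ a , φ b) Pair.≈ (φ c , φ d)
  pair-cong φ-cong (inj₁ (a≈c , b≈d)) = inj₁ (φ-cong a≈c , φ-cong b≈d)
  pair-cong φ-cong (inj₂ (a≈d , b≈c)) = inj₂ (φ-cong a≈d , φ-cong b≈c)

  -- The action of xσ on edges.

  module _ (S : Subset setoid) where

    -- Given on representatives `(g , s)`. The endpoints of the image are the images of the
    -- endpoints under the vertex map, so equal edges have equal images.
    edgePerm : ∀ σ → σ ∈ A S → Carrier → Perm (Edge S)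
    edgePerm σ σ∈A x = record
      { to        = to
      ; from      = from
      ; to-cong   = λ {e} {e′} → to-cong {e} {e′}
      ; from-cong = λ {e} {e′} → from-cong {e} {e′}
      ; inverse   =
          (λ {e} {e′} p → E.trans {to e′} {to (from e)} {e} (to-cong {e′} {from e} p)
            (inj₁ (θ.strictlyInverseˡ _ , ∙-cong (σ.strictlyInverseˡ _) (θ.strictlyInverseˡ _)))) ,
          (λ {e} {e′} p → E.trans {from e′} {from (to e)} {e} (from-cong {e′} {to e} p)
            (inj₁ (θ.strictlyInverseʳ _ , ∙-cong (σ.strictlyInverseʳ _) (θ.strictlyInverseʳ _))))
      }
      where
      module E = Setoid (Edge S)
      module σ = Automorphism σ
      module θ = Inverse (vertexPerm σ x)
      module σ∣S = Inverse (induced S σ σ∈A)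

      to from : E.Carrier → E.Carrier
      to   (g , s) = θ.to g , σ∣S.to s
      from (g , s) = θ.from g , σ∣S.from s

      to-cong : Congruent E._≈_ E._≈_ to
      to-cong {g , (s , _)} {h , (t , _)} p =
        Pair.trans (inj₁ (refl , vertexPerm-∙ σ x s g))
          (Pair.trans (pair-cong θ.to-cong p) (inj₁ (refl , sym (vertexPerm-∙ σ x t h))))

      from-cong : Congruent E._≈_ E._≈_ from
      from-cong {g , (s , _)} {h , (t , _)} p =
        Pair.trans (inj₁ (refl , vertexPerm-from-∙ σ x s g))
          (Pair.trans (pair-cong θ.from-cong p) (inj₁ (refl , sym (vertexPerm-from-∙ σ x t h))))

    edgePerm-mapsTo : ∀ σ (σ∈A : σ ∈ A S) (e e′ : Setoid.Carrier (Edge S)) →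
                      Automorphism.to σ (proj₁ (proj₂ e)) ≈± proj₁ (proj₂ e′) →
                      ∃[ x ] Setoid._≈_ (Edge S) (Inverse.to (edgePerm σ σ∈A x) e) e′
    edgePerm-mapsTo σ σ∈A (g , (s , _)) (h , (t , _)) (inj₁ σs≈t) =
      let x , θg≈h = vertexPerm-mapsTo σ g h in
      x , inj₁ (θg≈h , ∙-cong σs≈t θg≈h)
    edgePerm-mapsTo σ σ∈A (g , (s , _)) (h , (t , _)) (inj₂ σs≈t⁻¹) =
      -- Here `g` is sent to the far endpoint `t ∙ h`; then `s ∙ g` goes to `t ⁻¹ ∙ (t ∙ h) = h`,
      -- and the edge is matched in reverse.
      let x , θg≈th = vertexPerm-mapsTo σ g (t ∙ h) in
      x , inj₂ (θg≈th , trans (∙-cong σs≈t⁻¹ θg≈th) (\\-leftDividesʳ t h))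

  -- Cayley codes and the orbits of L.

  module _ (F : FiniteField ℓ) where

    open Codes F
    open CodeAutomorphisms F
    private
      module F = FiniteField F

    -- The star at `g` of the moved word is the star of `f` at the preimage of `g`, moved by the
    -- permutation that `σ` induces on `S`; that permutation preserves `B`.
    edgePerm∈Aut : ∀ (S : Subset setoid) (B : LinearCode ⟦ S ⟧) σ ((σ∈A , _) : L F S B σ) x →
                   edgePerm S σ σ∈A x ∈ Aut (cayleyCode F S B)
    edgePerm∈Aut S B σ (σ∈A , σ∈Aut) x = Aut-intro (cayleyCode F S B) (edgePerm S σ σ∈A x)
      (λ f f∈ g → LinearCode.respects B (λ _ → F.refl)
        (proj₁ (σ∈Aut (star F S f (Inverse.from θ g))) (f∈ (Inverse.from θ g))))
      (λ f f∈ g → LinearCode.respects B (λ _ → F.refl)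
        (proj₁ (Aut-inverse B (induced S σ σ∈A) σ∈Aut (star F S f (Inverse.to θ g)))
               (f∈ (Inverse.to θ g))))
      where θ = vertexPerm σ x

    L-restrict : ∀ {S T : Subset setoid} (B : LinearCode ⟦ S ⟧) (T⊆S : Mem T ⊆ Mem S) σ →
                 σ ∈ A T → σ ∈ L F S B → σ ∈ L F T (restrict B (inclusion T S T⊆S))
    L-restrict {S} {T} B T⊆S σ σ∈AT (σ∈AS , σ∈Aut) =
      σ∈AT , Aut-restrict B (inclusion T S T⊆S) (induced S σ σ∈AS) (induced T σ σ∈AT) σ∈Aut
               (λ _ → refl)

    module _ {S : Subset setoid} (B : LinearCode ⟦ S ⟧) where

      L-id : idᴬ ∈ L F S B
      L-id = A-id {S} ,
        Aut-resp B (Id.inverse ⟦ S ⟧) (induced S idᴬ (A-id {S})) (λ _ → refl) (Aut-id B)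

      L-inverse : ∀ σ → σ ∈ L F S B → inverseᴬ σ ∈ L F S B
      L-inverse σ (σ∈A , σ∈Aut) = σ⁻¹∈A ,
        Aut-resp B (Symmetry.inverse (induced S σ σ∈A)) (induced S (inverseᴬ σ) σ⁻¹∈A)
          (λ _ → refl) (Aut-inverse B (induced S σ σ∈A) σ∈Aut)
        where σ⁻¹∈A = A-inverse {S} σ σ∈A

      L-compose : ∀ σ τ → σ ∈ L F S B → τ ∈ L F S B → composeᴬ σ τ ∈ L F S B
      L-compose σ τ (σ∈A , σ∈Aut) (τ∈A , τ∈Aut) = στ∈A ,
        Aut-resp B (Compose.inverse (induced S σ σ∈A) (induced S τ τ∈A))
          (induced S (composeᴬ σ τ) στ∈A) (λ _ → refl)
          (Aut-compose B (induced S σ σ∈A) (induced S τ τ∈A) σ∈Aut τ∈Aut)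
        where στ∈A = A-compose {S} σ τ σ∈A τ∈A

      infix 4 _~_

      -- The orbit relation of the group generated by L and inversion. One `σ` and one sign suffice
      -- because automorphisms commute with inversion.
      _~_ : Carrier → Carrier → Set ℓ
      s ~ t = ∃[ σ ] σ ∈ L F S B × Automorphism.to σ s ≈± t

      ~-refl : ∀ {s} → s ~ s
      ~-refl = idᴬ , L-id , inj₁ refl

      ~-sym : ∀ {s t} → s ~ t → t ~ s
      ~-sym {s} (σ , σ∈L , σs≈±t) = inverseᴬ σ , L-inverse σ σ∈L ,
        ≈±-respʳ (Automorphism.strictlyInverseʳ σ s) (≈±-map (inverseᴬ σ) (≈±-sym σs≈±t))

      ~-trans : ∀ {s t u} → s ~ t → t ~ u → s ~ u
      ~-trans (σ , σ∈L , σs≈±t) (τ , τ∈L , τt≈±u) =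
        composeᴬ σ τ , L-compose σ τ σ∈L τ∈L , ≈±-trans (≈±-map τ σs≈±t) τt≈±u

      ~-respʳ : ∀ {s t u} → t ≈ u → s ~ t → s ~ u
      ~-respʳ t≈u (σ , σ∈L , σs≈±t) = σ , σ∈L , ≈±-respʳ t≈u σs≈±t

      ~-⁻¹ : ∀ {s t} → s ~ t → s ~ t ⁻¹
      ~-⁻¹ (σ , σ∈L , σs≈±t) = σ , σ∈L , ≈±-⁻¹ʳ σs≈±t

      -- Indexing by the elements of `S`, with `_~_` as equality of indices, avoids choosing orbit
      -- representatives.
      orbitPartition : Partition S
      orbitPartition = record
        { Index = record
          { Carrier       = Setoid.Carrier ⟦ S ⟧
          ; _≈_           = λ (s , _) (t , _) → s ~ t
          ; isEquivalence = record { refl = ~-refl ; sym = ~-sym ; trans = ~-trans }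
          }
        ; part = λ (s , _) → record
          { Mem      = λ t → t ∈ Mem S × s ~ t
          ; respects = λ t≈u (t∈ , s~t) → Subset.respects S t≈u t∈ , ~-respʳ t≈u s~t
          }
        ; respects-≈ = λ s~t (u∈ , s~u) → u∈ , ~-trans (~-sym s~t) s~u
        ; nonempty   = λ (s , s∈) → s , s∈ , ~-refl
        ; part⊆      = λ _ → proj₁
        ; cover      = λ {s} s∈ → (s , s∈) , s∈ , ~-refl
        ; disjoint   = λ (_ , s~u) (_ , t~u) → ~-trans s~u (~-sym t~u)
        }

      orbitPartition-invariant : InverseClosed S → IsInvariantPartition F B orbitPartition
      orbitPartition-invariant inv = record
        { inverseClosed = λ _ (t∈ , s~t) → inv t∈ , ~-⁻¹ s~t
        ; L-invariant   = λ _ σ σ∈L@((S^σ⊆S , S⊆S^σ) , _) →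
            -- The image of a part under `σ` is tested at `σ⁻¹ t`, so invariance amounts to `t` and
            -- `σ⁻¹ t` sharing an orbit.
            let t~σ⁻¹t t = inverseᴬ σ , L-inverse σ σ∈L , inj₁ refl in
            (λ {t} (t∈ , s~t) → S^σ⊆S t∈ , ~-trans s~t (~-sym (t~σ⁻¹t t))) ,
            (λ {t} (t∈ , s~t) → S⊆S^σ t∈ , ~-trans s~t (t~σ⁻¹t t))
        }

      -- Transitivity on the parts of the finest partition.

      module _ (inv : InverseClosed S) (P : Partition S)
               (finest : IsFinestInvariantPartition F B P) where

        open Partition P
        open IsFinestInvariantPartition finest using (L-invariant) renaming (finest to refines)

        -- The finest partition refines the orbit partition, so `s` and `t` are both related to the
        -- index of one orbit.
        part⇒~ : ∀ i {s t} → s ∈ Mem (part i) → t ∈ Mem (part i) → s ~ t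
        part⇒~ i s∈ t∈ =
          let _ , part⊆orbit = refines orbitPartition (orbitPartition-invariant inv) i
              _ , u~s = part⊆orbit s∈
              _ , u~t = part⊆orbit t∈
          in ~-trans (~-sym u~s) u~t

        -- The common source of both transitivity claims: `σ` in A(G,Sᵢ) gives the graph statement,
        -- and its action on Bᵢ gives the code statement.
        edges-transitive : ∀ i (e e′ : Setoid.Carrier (Edge (part i))) →
          ∃[ σ ] Σ[ σ∈L ∈ σ ∈ L F (part i) (restrictTo F B P i) ]
          ∃[ x ] Setoid._≈_ (Edge (part i)) (Inverse.to (edgePerm (part i) σ (proj₁ σ∈L) x) e) e′
        edges-transitive i e@(_ , (_ , s∈)) e′@(_ , (_ , t∈)) =
          let σ , σ∈L , σs≈±t = part⇒~ i s∈ t∈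
              σ∈A = L-invariant i σ σ∈L
          in σ , L-restrict {S} {part i} B (part⊆ i) σ σ∈A σ∈L ,
             edgePerm-mapsTo (part i) σ σ∈A e e′ σs≈±t

        part-normalEdgeTransitive : ∀ i → IsNormalEdgeTransitive (part i)
        part-normalEdgeTransitive i e@(g , (s , _)) e′ =
          let σ , (σ∈A , _) , x , p = edges-transitive i e e′ in
          -- The far endpoint given by `edgePerm` is `σ s` times the image of `g`; the goal has the
          -- image of `s ∙ g`.
          x , σ , σ∈A , Pair.trans (inj₁ (refl , sym (vertexPerm-∙ σ x s g))) p

        part-symmetric : ∀ i → IsSymmetric (cayleyCode F (part i) (restrictTo F B P i))
        part-symmetric i e e′ =
          let σ , σ∈L , x , p = edges-transitive i e e′ in
          edgePerm (part i) σ (proj₁ σ∈L) x ,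
          edgePerm∈Aut (part i) (restrictTo F B P i) σ σ∈L x , p

    -- Both sides say that for every vertex `g` and index `i` the star at `g`, restricted to part
    -- `i`, lies in `C i`; only the order of the quantifiers differs.
    cayleyCode-⨁ : ∀ {S : Subset setoid} (B : LinearCode ⟦ S ⟧) (P : Partition S)
                   (let open Partition P) (inv : ∀ i → InverseClosed (part i))
                   (C : ∀ i → LinearCode ⟦ part i ⟧) →
                   B ≐ᶜ ⨁ (partitionUnion P) C →
                   cayleyCode F S B ≐ᶜ ⨁ (edgeUnion P inv) (λ i → cayleyCode F (part i) (C i))
    cayleyCode-⨁ B P inv C (B⊆⨁ , ⨁⊆B) =
      (λ f∈ i g → LinearCode.respects (C i) (λ _ → F.refl) (B⊆⨁ (f∈ g) i)) ,
      (λ f∈ g → ⨁⊆B (λ i → LinearCode.respects (C i) (λ _ → F.refl) (f∈ i g)))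

theorem1p3 :
    ∀ {ℓ} (G : Group ℓ ℓ) (F : FiniteField ℓ) (let open Group G) (let open Cayley G) (let open Codes F) →
    IsFinite setoid →
    (S : Subset setoid) → Nonempty S → InverseClosed S → ε ∉ Mem S →
    (B : LinearCode ⟦ S ⟧) (P : Partition S) (let open Partition P) →
    (finest : IsFinestInvariantPartition F B P) →
    let B⟨_⟩ = restrictTo F B P
        inv  = IsFinestInvariantPartition.inverseClosed finest
    in
    (∀ i → IsNormalEdgeTransitive (part i) × IsSymmetric (cayleyCode F (part i) B⟨ i ⟩))
    × (B ≐ᶜ ⨁ (partitionUnion P) B⟨_⟩ →
       cayleyCode F S B ≐ᶜ ⨁ (edgeUnion P inv) (λ i → cayleyCode F (part i) B⟨ i ⟩))
theorem1p3 G F _ S _ S⁻¹ _ B P finest =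
  (λ i → part-normalEdgeTransitive F B S⁻¹ P finest i , part-symmetric F B S⁻¹ P finest i) ,
  cayleyCode-⨁ F B P inverseClosed (restrictTo F B P)
  where
  open Cayley G using (restrictTo)
  open Cayley.IsFinestInvariantPartition finest using (inverseClosed)
  open CayleyAutomorphisms G
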